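{- Let $G$ be a matrix weighted connected graph of order $n$ in which each weight is a positive definite matrix of order $k$, and let $L=L(G)$ and $R=R(G)$. Then $$\|L\boxtimes R\|=-2(n-1)I_k.$$
   Context: A matrix weighted graph is a finite, simple, undirected, connected graph in which each edge $ij$ is assigned a weight $W_{ij}=W_{ji}$ that is a (real symmetric) positive definite matrix of a given order $k$. For a matrix weighted graph $G$ with vertices $1,\dots,n$, the Laplacian $L=L(G)$ is the $nk\times nk$ block matrix with $k\times k$ blocks $L_{ii}=\sum_{j\sim i}W_{ij}^{ -1}$, $L_{ij}=-W_{ij}^{ -1}$ if $i\neq j$ and $i\sim j$, and $L_{ij}=0$ if $i\ne j$ and $i\nsim j$. A $(1)$-inverse of a matrix $M$ is a matrix $C$ with $MCM=M$. The resistance matrix $R=R(G)$ is the $nk\times nk$ block matrix with blocks $R_{ij}=L^{(1)}_{ii}+L^{(1)}_{jj}-L^{(1)}_{ij}-L^{(1)}_{ji}$, where $L^{(1)}$ is any $(1)$-inverse of $L$ (the result does not depend on the choice). For block matrices $M,N$ with the same block partition, $M\boxtimes N$ is the block matrix whose $ij$-th block is the matrix product $M_{ij}N_{ij}$. For a block matrix $M$ with all blocks of the same order, $\|M\|=\sum_{i,j}M_{ij}$ is the sum of all blocks of $M$ (a $k\times k$ matrix, not a norm). $I_k$ is the identity matrix of order $k$. -}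

module Defs where

open import Algebra.Apartness.Bundles using (HeytingField)
open import Algebra.Bundles using (CommutativeRing)
open import Algebra.Definitions using (Invertible)
open import Data.Fin.Base using (Fin; zero; suc; combine; quotient; remainder)
open import Data.Fin.Properties using (_≟_)
open import Data.Nat.Base as ℕ using (ℕ; zero; suc)
open import Data.Product using (∃-syntax; _,_; proj₁; proj₂) renaming (_×_ to _∧_)
open import Data.Sum using (_⊎_; inj₁; inj₂)
open import Function.Base using (_∘_)
open import Level using (_⊔_; 0ℓ) renaming (suc to lsuc)
open import Relation.Binary using (Rel; Decidable; Symmetric; IsStrictPartialOrder)
open import Relation.Binary.Construct.Closure.ReflexiveTransitive using (Star)
open import Relation.Binary.PropositionalEquality as ≡ using ()
open import Relation.Nullary using (¬_; yes; no; contradiction)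
import Algebra.Definitions.RawMonoid as RawMonoidDefinitions
import Algebra.Properties.AbelianGroup as AbelianGroupProperties
import Algebra.Properties.Ring as RingProperties
import Algebra.Properties.Semiring.Sum as SemiringSum
import Relation.Binary.Reasoning.Setoid as SetoidReasoning

-- The real numbers, given by their axioms: a Cauchy-complete Archimedean
-- ordered field.  Classically this determines ℝ up to isomorphism.  The axioms
-- are phrased constructively (_#_ is the positive form of ≠, and the order is
-- not assumed decidable), so Bishop's reals satisfy them as well.
record RealNumbers c ℓ₁ ℓ₂ : Set (lsuc (c ⊔ ℓ₁ ⊔ ℓ₂)) where
  infix 4 _<_
  field
    heytingField : HeytingField c ℓ₁ ℓ₂

  open HeytingField heytingField public hiding (zero)

  commutativeRing : CommutativeRing c ℓ₁
  commutativeRing = record { isCommutativeRing = isCommutativeRing }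

  open CommutativeRing commutativeRing public
    using (ring; semiring; +-abelianGroup; +-rawMonoid)

  fromℕ : ℕ → Carrier
  fromℕ n = RawMonoidDefinitions._×_ +-rawMonoid n 1#

  field
    _<_                    : Rel Carrier ℓ₂
    <-isStrictPartialOrder : IsStrictPartialOrder _≈_ _<_
    #⇒<⊎>                  : ∀ {x y} → x # y → x < y ⊎ y < x
    <⇒#                    : ∀ {x y} → x < y → x # y
    +-monoˡ-<              : ∀ {x y} z → x < y → x + z < y + z
    *-pos                  : ∀ {x y} → 0# < x → 0# < y → 0# < x * y
    archimedean            : ∀ x → ∃[ n ] x < fromℕ n

  -- Applied to both (m , n) and (n , m), the bound gives |s m - s n| < ε.
  IsCauchy : (ℕ → Carrier) → Set (c ⊔ ℓ₂)
  IsCauchy s = ∀ {ε} → 0# < ε → ∃[ N ] ∀ m n → N ℕ.≤ m → N ℕ.≤ n → s m < s n + ε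

  _ConvergesTo_ : (ℕ → Carrier) → Carrier → Set (c ⊔ ℓ₂)
  s ConvergesTo l = ∀ {ε} → 0# < ε → ∃[ N ] ∀ n → N ℕ.≤ n → (s n < l + ε) ∧ (l < s n + ε)

  field
    complete : ∀ s → IsCauchy s → ∃[ l ] s ConvergesTo l

module Matrices {c ℓ₁ ℓ₂} (ℝ : RealNumbers c ℓ₁ ℓ₂) where

  open RealNumbers ℝ
  open SemiringSum semiring

  infix  4 _≈ᴹ_
  infixl 6 _+ᴹ_ _-ᴹ_
  infixl 7 _·_ _·ᵛ_ _∙_
  infixr 7 _•_
  infix  8 -ᴹ_ _⁻¹

  Vector : ℕ → Set c
  Vector n = Fin n → Carrier

  Matrix : ℕ → ℕ → Set c
  Matrix m n = Fin m → Fin n → Carrier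

  _≈ᴹ_ : ∀ {m n} → Rel (Matrix m n) ℓ₁
  A ≈ᴹ B = ∀ i j → A i j ≈ B i j

  0ᴹ : ∀ {m n} → Matrix m n
  0ᴹ i j = 0#

  1ᴹ : ∀ {n} → Matrix n n
  1ᴹ i j with i ≟ j
  ... | yes _ = 1#
  ... | no  _ = 0#

  _+ᴹ_ _-ᴹ_ : ∀ {m n} → Matrix m n → Matrix m n → Matrix m n
  (A +ᴹ B) i j = A i j + B i j
  (A -ᴹ B) i j = A i j - B i j

  -ᴹ_ : ∀ {m n} → Matrix m n → Matrix m n
  (-ᴹ A) i j = - A i j

  _•_ : ∀ {m n} → Carrier → Matrix m n → Matrix m n
  (x • A) i j = x * A i j

  _·_ : ∀ {l m n} → Matrix l m → Matrix m n → Matrix l n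
  _·_ {m = m} A B i j = ∑[ p < m ] (A i p * B p j)

  ∑ᴹ : ∀ {l m n} → (Fin l → Matrix m n) → Matrix m n
  ∑ᴹ {l} A i j = ∑[ p < l ] A p i j

  _·ᵛ_ : ∀ {m n} → Matrix m n → Vector n → Vector m
  _·ᵛ_ {n = n} A x i = ∑[ j < n ] (A i j * x j)

  _∙_ : ∀ {n} → Vector n → Vector n → Carrier
  _∙_ {n} x y = ∑[ i < n ] (x i * y i)

  IsSymmetric : ∀ {n} → Matrix n n → Set ℓ₁
  IsSymmetric A = ∀ i j → A i j ≈ A j i

  -- Some coordinate is apart from 0; classically, x ≠ 0.
  Nonzero : ∀ {n} → Vector n → Set ℓ₂
  Nonzero x = ∃[ i ] x i # 0#

  record PositiveDefinite {n} (A : Matrix n n) : Set (c ⊔ ℓ₁ ⊔ ℓ₂) where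
    field
      symmetric : IsSymmetric A
      positive  : ∀ x → Nonzero x → 0# < x ∙ (A ·ᵛ x)

  IsOneInverse : ∀ {m n} → Matrix m n → Matrix n m → Set ℓ₁
  IsOneInverse M C = M · C · M ≈ᴹ M

  -- Towards invertibility of positive definite matrices, by elimination of the first
  -- unknown: the Schur complement again has a positive quadratic form.
  private
    open AbelianGroupProperties +-abelianGroup using (ε⁻¹≈ε; xyx⁻¹≈y)
    open RingProperties ring using (-‿distribˡ-*; -‿distribʳ-*)
    open SetoidReasoning setoid

    HasPositiveForm : ∀ {n} → Matrix n n → Set (c ⊔ ℓ₂)
    HasPositiveForm A = ∀ x → Nonzero x → 0# < x ∙ (A ·ᵛ x)

    <-respʳ-≈ : ∀ {x y z} → y ≈ z → x < y → x < z
    <-respʳ-≈ = proj₁ (IsStrictPartialOrder.<-resp-≈ <-isStrictPartialOrder)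

    sum-cong : ∀ {n} {f g : Vector n} → (∀ i → f i ≈ g i) → sum f ≈ sum g
    sum-cong = sum-cong-≋

    sum-zero : ∀ {n} (f : Vector n) → (∀ i → f i ≈ 0#) → sum f ≈ 0#
    sum-zero {n} f f≈0 = trans (sum-cong f≈0) (sum-replicate-zero n)

    x+[y-x]≈y : ∀ x y → x + (y - x) ≈ y
    x+[y-x]≈y x y = trans (sym (+-assoc x y (- x))) (xyx⁻¹≈y x y)

    1##0 : 1# # 0#
    1##0 = invertible⇒# (1# , trans (*-identityˡ _) 1-0 , trans (*-identityʳ _) 1-0)
      where
      1-0 : 1# - 0# ≈ 1#
      1-0 = trans (+-congˡ ε⁻¹≈ε) (+-identityʳ 1#)

    pos⇒rightInverse : ∀ {a} → 0# < a → ∃[ b ] a * b ≈ 1#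
    pos⇒rightInverse {a} 0<a with #⇒invertible (#-sym (<⇒# 0<a))
    ... | b , _ , [a-0]b≈1 = b , trans (*-congʳ (sym a-0≈a)) [a-0]b≈1
      where
      a-0≈a : a - 0# ≈ a
      a-0≈a = trans (+-congˡ ε⁻¹≈ε) (+-identityʳ a)

    module Elimination {n} (A : Matrix (suc n) (suc n)) (A-pos : HasPositiveForm A) where

      a : Carrier
      a = A zero zero

      r q : Vector n
      r j = A zero (suc j)
      q i = A (suc i) zero

      e₀ : Vector (suc n)
      e₀ zero    = 1#
      e₀ (suc _) = 0#

      e₀Ae₀ : e₀ ∙ (A ·ᵛ e₀) ≈ a
      e₀Ae₀ = begin
        1# * (a * 1# + sum (λ j → r j * 0#)) + sum (λ i → 0# * (A ·ᵛ e₀) (suc i))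
          ≈⟨ +-cong (*-identityˡ _) (sum-zero (λ i → 0# * (A ·ᵛ e₀) (suc i)) (λ i → zeroˡ _)) ⟩
        a * 1# + sum (λ j → r j * 0#) + 0#
          ≈⟨ +-identityʳ _ ⟩
        a * 1# + sum (λ j → r j * 0#)
          ≈⟨ +-cong (*-identityʳ a) (sum-zero (λ j → r j * 0#) (λ j → zeroʳ (r j))) ⟩
        a + 0#
          ≈⟨ +-identityʳ a ⟩
        a ∎

      pivot : ∃[ b ] a * b ≈ 1#
      pivot = pos⇒rightInverse (<-respʳ-≈ e₀Ae₀ (A-pos e₀ (zero , 1##0)))

      b : Carrier
      b = proj₁ pivot

      a*[b*x]≈x : ∀ x → a * (b * x) ≈ x
      a*[b*x]≈x x = trans (sym (*-assoc a b x)) (trans (*-congʳ (proj₂ pivot)) (*-identityˡ x))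

      schur : Matrix n n
      schur i j = A (suc i) (suc j) - q i * (b * r j)

      schur-row : ∀ y i → (schur ·ᵛ y) i + q i * (b * (r ∙ y)) ≈ sum (λ j → A (suc i) (suc j) * y j)
      schur-row y i = begin
        (schur ·ᵛ y) i + q i * (b * (r ∙ y))
          ≈⟨ +-congˡ (trans (sym (*-assoc (q i) b _)) (*-distribˡ-sum (q i * b) (λ j → r j * y j))) ⟩
        (schur ·ᵛ y) i + sum (λ j → q i * b * (r j * y j))
          ≈⟨ sym (∑-distrib-+ (λ j → schur i j * y j) (λ j → q i * b * (r j * y j))) ⟩
        sum (λ j → schur i j * y j + q i * b * (r j * y j))
          ≈⟨ sum-cong entry ⟩
        sum (λ j → A (suc i) (suc j) * y j) ∎
        where
        entry : ∀ j → schur i j * y j + q i * b * (r j * y j) ≈ A (suc i) (suc j) * y j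
        entry j = begin
          schur i j * y j + q i * b * (r j * y j)
            ≈⟨ +-congˡ (trans (sym (*-assoc (q i * b) (r j) (y j))) (*-congʳ (*-assoc (q i) b (r j)))) ⟩
          schur i j * y j + q i * (b * r j) * y j
            ≈⟨ sym (distribʳ (y j) (schur i j) (q i * (b * r j))) ⟩
          (A (suc i) (suc j) - q i * (b * r j) + q i * (b * r j)) * y j
            ≈⟨ *-congʳ (trans (+-comm _ _) (x+[y-x]≈y _ _)) ⟩
          A (suc i) (suc j) * y j ∎

      extend : Carrier → Vector n → Vector (suc n)
      extend v₀ y zero    = b * (v₀ - r ∙ y)
      extend v₀ y (suc i) = y i

      A·extend-zero : ∀ v₀ y → (A ·ᵛ extend v₀ y) zero ≈ v₀
      A·extend-zero v₀ y = trans (+-congʳ (a*[b*x]≈x (v₀ - r ∙ y))) (trans (+-comm _ _) (x+[y-x]≈y (r ∙ y) v₀))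

      A·extend-suc : ∀ v₀ y i → (A ·ᵛ extend v₀ y) (suc i) ≈ q i * (b * v₀) + (schur ·ᵛ y) i
      A·extend-suc v₀ y i = begin
        q i * (b * (v₀ - r ∙ y)) + sum (λ j → A (suc i) (suc j) * y j)
          ≈⟨ +-congˡ (trans (sym (schur-row y i)) (+-comm _ _)) ⟩
        q i * (b * (v₀ - r ∙ y)) + (q i * (b * (r ∙ y)) + (schur ·ᵛ y) i)
          ≈⟨ sym (+-assoc _ _ _) ⟩
        q i * (b * (v₀ - r ∙ y)) + q i * (b * (r ∙ y)) + (schur ·ᵛ y) i
          ≈⟨ +-congʳ (trans (sym (distribˡ (q i) _ _)) (*-congˡ (sym (distribˡ b _ _)))) ⟩
        q i * (b * (v₀ - r ∙ y + r ∙ y)) + (schur ·ᵛ y) i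
          ≈⟨ +-congʳ (*-congˡ (*-congˡ (trans (+-comm _ _) (x+[y-x]≈y (r ∙ y) v₀)))) ⟩
        q i * (b * v₀) + (schur ·ᵛ y) i ∎

      schur-pos : HasPositiveForm schur
      schur-pos y (i , yi#0) = <-respʳ-≈ form (A-pos (extend 0# y) (suc i , yi#0))
        where
        row : ∀ i → (A ·ᵛ extend 0# y) (suc i) ≈ (schur ·ᵛ y) i
        row i = begin
          (A ·ᵛ extend 0# y) (suc i)       ≈⟨ A·extend-suc 0# y i ⟩
          q i * (b * 0#) + (schur ·ᵛ y) i  ≈⟨ +-congʳ (trans (*-congˡ (zeroʳ b)) (zeroʳ (q i))) ⟩
          0# + (schur ·ᵛ y) i              ≈⟨ +-identityˡ _ ⟩
          (schur ·ᵛ y) i                   ∎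

        form : extend 0# y ∙ (A ·ᵛ extend 0# y) ≈ y ∙ (schur ·ᵛ y)
        form = trans
          (+-cong (trans (*-congˡ (A·extend-zero 0# y)) (zeroʳ _)) (sum-cong (λ i → *-congˡ (row i))))
          (+-identityˡ _)

    solve : ∀ {n} (A : Matrix n n) → HasPositiveForm A →
            ∀ (v : Vector n) → ∃[ x ] ∀ i → (A ·ᵛ x) i ≈ v i
    solve {zero}  A A-pos v = (λ ()) , λ ()
    solve {suc n} A A-pos v = x , correct
      where
      open Elimination A A-pos

      reduced : ∃[ y ] ∀ i → (schur ·ᵛ y) i ≈ v (suc i) - q i * (b * v zero)
      reduced = solve schur schur-pos (λ i → v (suc i) - q i * (b * v zero))

      x : Vector (suc n)
      x = extend (v zero) (proj₁ reduced)

      correct : ∀ i → (A ·ᵛ x) i ≈ v i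
      correct zero    = A·extend-zero (v zero) (proj₁ reduced)
      correct (suc i) = trans (A·extend-suc (v zero) (proj₁ reduced) i)
                              (trans (+-congˡ (proj₂ reduced i)) (x+[y-x]≈y _ _))

    1ᴹ-sym : ∀ {n} (i j : Fin n) → 1ᴹ i j ≈ 1ᴹ j i
    1ᴹ-sym i j with i ≟ j | j ≟ i
    ... | yes _   | yes _   = refl
    ... | no  _   | no  _   = refl
    ... | yes i≡j | no  j≢i = contradiction (≡.sym i≡j) j≢i
    ... | no  i≢j | yes j≡i = contradiction (≡.sym j≡i) i≢j

    1ᴹ-suc : ∀ {n} (i j : Fin n) → 1ᴹ (suc i) (suc j) ≈ 1ᴹ i j
    1ᴹ-suc i j with i ≟ j
    ... | yes _ = refl
    ... | no  _ = refl

    1ᴹ·ᵛ : ∀ {n} (x : Vector n) i → (1ᴹ ·ᵛ x) i ≈ x i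
    1ᴹ·ᵛ x zero    = trans (+-cong (*-identityˡ _) (sum-zero (λ j → 0# * x (suc j)) (λ j → zeroˡ _))) (+-identityʳ _)
    1ᴹ·ᵛ x (suc i) = trans (+-cong (zeroˡ _) (sum-cong (λ j → *-congʳ (1ᴹ-suc i j))))
                           (trans (+-identityˡ _) (1ᴹ·ᵛ (x ∘ suc) i))

    ·-assoc : ∀ {k l m n} (A : Matrix k l) (B : Matrix l m) (C : Matrix m n) →
              A · B · C ≈ᴹ A · (B · C)
    ·-assoc A B C i j = begin
      sum (λ q → sum (λ p → A i p * B p q) * C q j)
        ≈⟨ sum-cong (λ q → *-distribʳ-sum (C q j) (λ p → A i p * B p q)) ⟩
      sum (λ q → sum (λ p → A i p * B p q * C q j))
        ≈⟨ ∑-comm (λ q p → A i p * B p q * C q j) ⟩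
      sum (λ p → sum (λ q → A i p * B p q * C q j))
        ≈⟨ sum-cong (λ p → sum-cong (λ q → *-assoc (A i p) (B p q) (C q j))) ⟩
      sum (λ p → sum (λ q → A i p * (B p q * C q j)))
        ≈⟨ sum-cong (λ p → sym (*-distribˡ-sum (A i p) (λ q → B p q * C q j))) ⟩
      sum (λ p → A i p * sum (λ q → B p q * C q j)) ∎

  positiveDefinite⇒invertible : ∀ {n} {A : Matrix n n} → PositiveDefinite A → Invertible _≈ᴹ_ 1ᴹ _·_ A
  positiveDefinite⇒invertible {n} {A} A-pd = B , BA≈1 , AB≈1
    where
    open PositiveDefinite A-pd

    column : ∀ j → ∃[ x ] ∀ i → (A ·ᵛ x) i ≈ 1ᴹ i j
    column j = solve A positive (λ i → 1ᴹ i j)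

    B Bᵀ : Matrix n n
    B i j = proj₁ (column j) i
    Bᵀ i j = B j i

    AB≈1 : A · B ≈ᴹ 1ᴹ
    AB≈1 i j = proj₂ (column j) i

    BᵀA≈1 : Bᵀ · A ≈ᴹ 1ᴹ
    BᵀA≈1 i j = trans (sum-cong (λ p → trans (*-comm _ _) (*-congʳ (symmetric p j))))
                      (trans (AB≈1 j i) (1ᴹ-sym j i))

    B≈Bᵀ : B ≈ᴹ Bᵀ
    B≈Bᵀ i j = begin
      B i j                ≈⟨ sym (1ᴹ·ᵛ (λ p → B p j) i) ⟩
      (1ᴹ · B) i j         ≈⟨ sum-cong (λ p → *-congʳ (sym (BᵀA≈1 i p))) ⟩
      (Bᵀ · A · B) i j     ≈⟨ ·-assoc Bᵀ A B i j ⟩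
      (Bᵀ · (A · B)) i j   ≈⟨ sum-cong (λ p → trans (*-comm _ _) (*-congʳ (trans (AB≈1 p j) (1ᴹ-sym p j)))) ⟩
      sum (λ p → 1ᴹ j p * Bᵀ i p) ≈⟨ 1ᴹ·ᵛ (Bᵀ i) j ⟩
      Bᵀ i j               ∎

    BA≈1 : B · A ≈ᴹ 1ᴹ
    BA≈1 i j = trans (sum-cong (λ p → *-congʳ (B≈Bᵀ i p))) (BᵀA≈1 i j)

  -- The inverse of A is written as a function of the evidence that A is positive definite.
  _⁻¹ : ∀ {n} {A : Matrix n n} → PositiveDefinite A → Matrix n n
  A-pd ⁻¹ = proj₁ (positiveDefinite⇒invertible A-pd)

-- Adjacency is decidable, as for any graph with a finite set of edges.
record SimpleGraph (n : ℕ) : Set₁ where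
  infix 4 _∼_ _∼?_
  field
    _∼_      : Rel (Fin n) 0ℓ
    _∼?_     : Decidable _∼_
    ∼-sym    : Symmetric _∼_
    loopless : ∀ {i} → ¬ i ∼ i

  Connected : Set
  Connected = ∀ i j → Star _∼_ i j

module MatrixWeighted {c ℓ₁ ℓ₂} (ℝ : RealNumbers c ℓ₁ ℓ₂) (n k : ℕ) where

  open Matrices ℝ

  infixl 7 _⊠_

  BlockMatrix : Set c
  BlockMatrix = Matrix (n ℕ.* k) (n ℕ.* k)

  block : BlockMatrix → Fin n → Fin n → Matrix k k
  block M i j a b = M (combine i a) (combine j b)

  fromBlocks : (Fin n → Fin n → Matrix k k) → BlockMatrix
  fromBlocks B p q = B (quotient k p) (quotient k q) (remainder {n} k p) (remainder {n} k q)

  _⊠_ : BlockMatrix → BlockMatrix → BlockMatrix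
  M ⊠ N = fromBlocks λ i j → block M i j · block N i j

  ‖_‖ : BlockMatrix → Matrix k k
  ‖ M ‖ = ∑ᴹ λ i → ∑ᴹ λ j → block M i j

  -- Only the weights of adjacent pairs are meaningful.
  record MatrixWeightedGraph : Set (lsuc 0ℓ ⊔ c ⊔ ℓ₁ ⊔ ℓ₂) where
    field
      graph : SimpleGraph n

    open SimpleGraph graph public

    field
      connected : Connected
      W         : Fin n → Fin n → Matrix k k
      W-sym     : ∀ {i j} → i ∼ j → W i j ≈ᴹ W j i
      W-posDef  : ∀ {i j} → i ∼ j → PositiveDefinite (W i j)

    W⁻¹ : ∀ {i j} → i ∼ j → Matrix k k
    W⁻¹ i∼j = W-posDef i∼j ⁻¹

  module _ (G : MatrixWeightedGraph) where

    open MatrixWeightedGraph G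

    edgeInverse : Fin n → Fin n → Matrix k k
    edgeInverse i j with i ∼? j
    ... | yes i∼j = W⁻¹ i∼j
    ... | no  _   = 0ᴹ

    laplacianBlock : Fin n → Fin n → Matrix k k
    laplacianBlock i j with i ≟ j | i ∼? j
    ... | yes _ | _       = ∑ᴹ (edgeInverse i)
    ... | no  _ | yes i∼j = -ᴹ W⁻¹ i∼j
    ... | no  _ | no  _   = 0ᴹ

    laplacian : BlockMatrix
    laplacian = fromBlocks laplacianBlock

  -- The argument stands for an arbitrary (1)-inverse of the Laplacian.
  resistance : BlockMatrix → BlockMatrix
  resistance C = fromBlocks λ i j → block C i i +ᴹ block C j j -ᴹ block C i j -ᴹ block C j i

-- Write M = L · C for a (1)-inverse C of L. Since the block rows and block columns of L
-- sum to zero and L_ij = L_ji, only the terms − L_ij C_ij and − L_ij C_ji of L ⊠ R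
-- contribute, and each of them adds up to minus the block trace of M. From M L = L every
-- row of M − I is a left null vector of L. By connectedness such a vector is constant
-- along the blocks: its energy Σ (xᵢ − xⱼ)ᵀ W_ij⁻¹ (xᵢ − xⱼ) vanishes. Hence the block trace
-- of M − I is the sum of any of its block columns, which is − I because the block columns
-- of M sum to zero. So the block trace of M is (n − 1) I.
module Submission where

open import Defs
open import Algebra.Bundles using (CommutativeRing)
open import Data.Fin.Base using (Fin; zero; suc; combine; _↑ˡ_; _↑ʳ_)
open import Data.Fin.Properties using (_≟_; remQuot-combine; combine-injective)
open import Data.Nat.Base as ℕ using (ℕ; NonZero)
open import Data.Product using (_,_; proj₁; proj₂)
open import Data.Sum using (inj₁; inj₂)
open import Function.Base using (_∘_)
open import Relation.Binary using (IsStrictPartialOrder)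
open import Relation.Binary.Construct.Closure.ReflexiveTransitive using (fold)
open import Relation.Binary.PropositionalEquality as ≡ using ()
open import Relation.Nullary using (¬_; yes; no; contradiction)
import Algebra.Properties.AbelianGroup as AbelianGroupProperties
import Algebra.Properties.CommutativeSemigroup as CommutativeSemigroupProperties
import Algebra.Properties.Ring as RingProperties
import Algebra.Properties.Semiring.Sum as SemiringSum
import Relation.Binary.Reasoning.Setoid as SetoidReasoning

module MatrixProperties {c ℓ₁ ℓ₂} (ℝ : RealNumbers c ℓ₁ ℓ₂) where

  open RealNumbers ℝ
  open Matrices ℝ
  open IsStrictPartialOrder <-isStrictPartialOrder
    using (<-respˡ-≈; <-respʳ-≈) renaming (irrefl to <-irrefl; trans to <-trans)
  open SemiringSum semiring
  open AbelianGroupProperties +-abelianGroup using (ε⁻¹≈ε; ⁻¹-∙-comm)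
  open RingProperties ring using (-‿distribˡ-*; -‿distribʳ-*)
  open SetoidReasoning setoid

  -- Nonnegative reals and vanishing sums.

  -- Encoded as a negation, because the order is not assumed decidable.
  Nonnegative : Carrier → Set ℓ₂
  Nonnegative x = ¬ x < 0#

  ¬#⇒≈ : ∀ {x y} → ¬ x # y → x ≈ y
  ¬#⇒≈ {x} {y} = proj₁ (tight x y)

  y<x+y : ∀ {x} y → 0# < x → y < x + y
  y<x+y y 0<x = <-respˡ-≈ (+-identityˡ y) (+-monoˡ-< y 0<x)

  -- Suppose `x + y < 0`. Then `x # 0#` is impossible: `0# < x` would give `y < x + y < 0#`.
  -- Tightness yields `x ≈ 0#`, which leaves `y < 0#`.
  nonnegative-+ : ∀ {x y} → Nonnegative x → Nonnegative y → Nonnegative (x + y)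
  nonnegative-+ {x} {y} x≥0 y≥0 x+y<0 =
    y≥0 (<-respˡ-≈ (trans (+-congʳ (¬#⇒≈ ¬x#0)) (+-identityˡ y)) x+y<0)
    where
    ¬x#0 : ¬ x # 0#
    ¬x#0 x#0 with #⇒<⊎> x#0
    ... | inj₁ x<0 = x≥0 x<0
    ... | inj₂ 0<x = y≥0 (<-trans (y<x+y y 0<x) x+y<0)

  -- Apartness of `x` from 0 is refuted on both sides: `0# < x` would give `y < x + y ≈ 0#`.
  -- Tightness concludes.
  nonnegative-+-zeroˡ : ∀ {x y} → Nonnegative x → Nonnegative y → x + y ≈ 0# → x ≈ 0#
  nonnegative-+-zeroˡ {x} {y} x≥0 y≥0 x+y≈0 = ¬#⇒≈ ¬x#0
    where
    ¬x#0 : ¬ x # 0#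
    ¬x#0 x#0 with #⇒<⊎> x#0
    ... | inj₁ x<0 = x≥0 x<0
    ... | inj₂ 0<x = y≥0 (<-respʳ-≈ x+y≈0 (y<x+y y 0<x))

  nonnegative-sum : ∀ {n} {f : Vector n} → (∀ i → Nonnegative (f i)) → Nonnegative (sum f)
  nonnegative-sum {ℕ.zero}  f≥0 = <-irrefl refl
  nonnegative-sum {ℕ.suc n} f≥0 = nonnegative-+ (f≥0 zero) (nonnegative-sum (f≥0 ∘ suc))

  nonnegative-sum-zero : ∀ {n} {f : Vector n} → (∀ i → Nonnegative (f i)) →
                         sum f ≈ 0# → ∀ i → f i ≈ 0#
  nonnegative-sum-zero f≥0 Σf≈0 zero =
    nonnegative-+-zeroˡ (f≥0 zero) (nonnegative-sum (f≥0 ∘ suc)) Σf≈0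
  nonnegative-sum-zero f≥0 Σf≈0 (suc i) = nonnegative-sum-zero (f≥0 ∘ suc)
    (nonnegative-+-zeroˡ (nonnegative-sum (f≥0 ∘ suc)) (f≥0 zero) (trans (+-comm _ _) Σf≈0)) i

  -- Finite sums, subtraction, and sums over block indices.

  sum-cong : ∀ {n} {f g : Vector n} → (∀ i → f i ≈ g i) → sum f ≈ sum g
  sum-cong = sum-cong-≋

  sum-zero : ∀ {n} {f : Vector n} → (∀ i → f i ≈ 0#) → sum f ≈ 0#
  sum-zero {n} f≈0 = trans (sum-cong f≈0) (sum-replicate-zero n)

  sum-neg : ∀ {n} (f : Vector n) → sum (λ i → - f i) ≈ - sum f
  sum-neg {ℕ.zero}  f = sym ε⁻¹≈ε
  sum-neg {ℕ.suc n} f = trans (+-congˡ (sum-neg (f ∘ suc))) (⁻¹-∙-comm _ _)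

  sum-sub : ∀ {n} (f g : Vector n) → sum (λ i → f i - g i) ≈ sum f - sum g
  sum-sub f g = trans (∑-distrib-+ f (λ i → - g i)) (+-congˡ (sum-neg g))

  *-distribˡ-- : ∀ x y z → x * (y - z) ≈ x * y - x * z
  *-distribˡ-- x y z = trans (distribˡ x y (- z)) (+-congˡ (sym (-‿distribʳ-* x z)))

  *-distribʳ-- : ∀ x y z → (y - z) * x ≈ y * x - z * x
  *-distribʳ-- x y z = trans (distribʳ x y (- z)) (+-congˡ (sym (-‿distribˡ-* z x)))

  x-0≈x : ∀ x → x - 0# ≈ x
  x-0≈x x = trans (+-congˡ ε⁻¹≈ε) (+-identityʳ x)

  sum-↑ : ∀ m {n} (f : Vector (m ℕ.+ n)) →
          sum f ≈ sum (λ i → f (i ↑ˡ n)) + sum (λ j → f (m ↑ʳ j))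
  sum-↑ ℕ.zero    f = sym (+-identityˡ _)
  sum-↑ (ℕ.suc m) f = trans (+-congˡ (sum-↑ m (f ∘ suc))) (sym (+-assoc _ _ _))

  sum-combine : ∀ n {k} (f : Vector (n ℕ.* k)) →
                sum f ≈ sum (λ i → sum (λ a → f (combine {n} {k} i a)))
  sum-combine ℕ.zero        f = refl
  sum-combine (ℕ.suc n) {k} f = trans (sum-↑ k f) (+-congˡ (sum-combine n (λ p → f (k ↑ʳ p))))

  -- The identity matrix as a Kronecker delta.

  1ᴹ-diagonal : ∀ {n} (i : Fin n) → 1ᴹ i i ≈ 1#
  1ᴹ-diagonal i with i ≟ i
  ... | yes _   = refl
  ... | no  i≢i = contradiction ≡.refl i≢i

  1ᴹ-sym : ∀ {n} (i j : Fin n) → 1ᴹ i j ≈ 1ᴹ j i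
  1ᴹ-sym i j with i ≟ j | j ≟ i
  ... | yes _   | yes _   = refl
  ... | no  _   | no  _   = refl
  ... | yes i≡j | no  j≢i = contradiction (≡.sym i≡j) j≢i
  ... | no  i≢j | yes j≡i = contradiction (≡.sym j≡i) i≢j

  1ᴹ-subst : ∀ {n} (i j : Fin n) (f : Vector n) → 1ᴹ i j * f i ≈ 1ᴹ i j * f j
  1ᴹ-subst i j f with i ≟ j
  ... | yes ≡.refl = refl
  ... | no  _      = trans (zeroˡ (f i)) (sym (zeroˡ (f j)))

  1ᴹ-suc : ∀ {n} (i j : Fin n) → 1ᴹ (suc i) (suc j) ≈ 1ᴹ i j
  1ᴹ-suc i j with i ≟ j
  ... | yes _ = refl
  ... | no  _ = refl

  -- The identity of order nk is the Kronecker product of the identities of orders n and k.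
  1ᴹ-combine : ∀ {m n} (i j : Fin m) (a b : Fin n) →
               1ᴹ (combine i a) (combine j b) ≈ 1ᴹ i j * 1ᴹ a b
  1ᴹ-combine i j a b with combine i a ≟ combine j b | i ≟ j | a ≟ b
  ... | yes _  | yes _      | yes _      = sym (*-identityˡ 1#)
  ... | yes eq | no i≢j     | _          = contradiction (proj₁ (combine-injective i a j b eq)) i≢j
  ... | yes eq | yes _      | no a≢b     = contradiction (proj₂ (combine-injective i a j b eq)) a≢b
  ... | no neq | yes ≡.refl | yes ≡.refl = contradiction ≡.refl neq
  ... | no _   | yes _      | no _       = sym (zeroʳ 1#)
  ... | no _   | no _       | _          = sym (zeroˡ _)

  sum-1ᴹ : ∀ {n} i (f : Vector n) → sum (λ j → 1ᴹ i j * f j) ≈ f i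
  sum-1ᴹ zero f =
    trans (+-cong (*-identityˡ _) (sum-zero {f = λ j → 0# * f (suc j)} (λ j → zeroˡ _))) (+-identityʳ _)
  sum-1ᴹ (suc i) f = trans (+-cong (zeroˡ _) (sum-cong (λ j → *-congʳ (1ᴹ-suc i j))))
                           (trans (+-identityˡ _) (sum-1ᴹ i (f ∘ suc)))

  -- Matrix algebra and inverses.

  ≈ᴹ-sym : ∀ {m n} {A B : Matrix m n} → A ≈ᴹ B → B ≈ᴹ A
  ≈ᴹ-sym A≈B i j = sym (A≈B i j)

  ≈ᴹ-trans : ∀ {m n} {A B C : Matrix m n} → A ≈ᴹ B → B ≈ᴹ C → A ≈ᴹ C
  ≈ᴹ-trans A≈B B≈C i j = trans (A≈B i j) (B≈C i j)

  ·-congˡ : ∀ {l m n} (A : Matrix l m) {B B′ : Matrix m n} → B ≈ᴹ B′ → A · B ≈ᴹ A · B′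
  ·-congˡ A B≈B′ i j = sum-cong (λ p → *-congˡ (B≈B′ p j))

  ·-congʳ : ∀ {l m n} {A A′ : Matrix l m} (B : Matrix m n) → A ≈ᴹ A′ → A · B ≈ᴹ A′ · B
  ·-congʳ B A≈A′ i j = sum-cong (λ p → *-congʳ (A≈A′ i p))

  ·-identityˡ : ∀ {m n} (A : Matrix m n) → 1ᴹ · A ≈ᴹ A
  ·-identityˡ A i j = sum-1ᴹ i (λ p → A p j)

  ·-identityʳ : ∀ {m n} (A : Matrix m n) → A · 1ᴹ ≈ᴹ A
  ·-identityʳ A i j =
    trans (sum-cong (λ p → trans (*-comm _ _) (*-congʳ (1ᴹ-sym p j)))) (sum-1ᴹ j (A i))

  ·-assoc : ∀ {k l m n} (A : Matrix k l) (B : Matrix l m) (C : Matrix m n) →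
            A · B · C ≈ᴹ A · (B · C)
  ·-assoc A B C i j = begin
    sum (λ q → sum (λ p → A i p * B p q) * C q j)
      ≈⟨ sum-cong (λ q → *-distribʳ-sum (C q j) (λ p → A i p * B p q)) ⟩
    sum (λ q → sum (λ p → A i p * B p q * C q j))
      ≈⟨ ∑-comm (λ q p → A i p * B p q * C q j) ⟩
    sum (λ p → sum (λ q → A i p * B p q * C q j))
      ≈⟨ sum-cong (λ p → sum-cong (λ q → *-assoc (A i p) (B p q) (C q j))) ⟩
    sum (λ p → sum (λ q → A i p * (B p q * C q j)))
      ≈⟨ sum-cong (λ p → *-distribˡ-sum (A i p) (λ q → B p q * C q j)) ⟨
    sum (λ p → A i p * sum (λ q → B p q * C q j)) ∎

  ·-distribʳ-- : ∀ {l m n} (A B : Matrix l m) (C : Matrix m n) →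
                 (A -ᴹ B) · C ≈ᴹ A · C -ᴹ B · C
  ·-distribʳ-- A B C i j =
    trans (sum-cong (λ p → *-distribʳ-- (C p j) (A i p) (B i p)))
          (sum-sub (λ p → A i p * C p j) (λ p → B i p * C p j))

  ⁻¹-inverseˡ : ∀ {n} {A : Matrix n n} (A-pd : PositiveDefinite A) → A-pd ⁻¹ · A ≈ᴹ 1ᴹ
  ⁻¹-inverseˡ A-pd = proj₁ (proj₂ (positiveDefinite⇒invertible A-pd))

  ⁻¹-inverseʳ : ∀ {n} {A : Matrix n n} (A-pd : PositiveDefinite A) → A · A-pd ⁻¹ ≈ᴹ 1ᴹ
  ⁻¹-inverseʳ A-pd = proj₂ (proj₂ (positiveDefinite⇒invertible A-pd))

  -- A⁻¹ = A⁻¹(BB⁻¹) = (A⁻¹A)B⁻¹ = B⁻¹. Inverses are attached to evidence of positive definiteness,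
  -- so this is what identifies the inverse weights of `i ∼ j` and `j ∼ i`.
  ⁻¹-cong : ∀ {n} {A B : Matrix n n} (A-pd : PositiveDefinite A) (B-pd : PositiveDefinite B) →
            A ≈ᴹ B → A-pd ⁻¹ ≈ᴹ B-pd ⁻¹
  ⁻¹-cong {n} {A} {B} A-pd B-pd A≈B =
    ≈ᴹ-trans (≈ᴹ-sym (·-identityʳ A⁻¹))
    (≈ᴹ-trans (·-congˡ A⁻¹ (≈ᴹ-sym (⁻¹-inverseʳ B-pd)))
    (≈ᴹ-trans (≈ᴹ-sym (·-assoc A⁻¹ B B⁻¹))
    (≈ᴹ-trans (·-congʳ B⁻¹ (≈ᴹ-trans (·-congˡ A⁻¹ (≈ᴹ-sym A≈B)) (⁻¹-inverseˡ A-pd)))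
    (·-identityˡ B⁻¹))))
    where
    A⁻¹ B⁻¹ : Matrix n n
    A⁻¹ = A-pd ⁻¹
    B⁻¹ = B-pd ⁻¹

  ·ᵛ-inverseʳ : ∀ {n} {A : Matrix n n} (A-pd : PositiveDefinite A) (x : Vector n) →
                ∀ i → (A ·ᵛ (A-pd ⁻¹ ·ᵛ x)) i ≈ x i
  ·ᵛ-inverseʳ {n} {A} A-pd x i = begin
    (A · (A-pd ⁻¹ · X)) i zero  ≈⟨ ·-assoc A (A-pd ⁻¹) X i zero ⟨
    (A · A-pd ⁻¹ · X) i zero    ≈⟨ ·-congʳ X (⁻¹-inverseʳ A-pd) i zero ⟩
    (1ᴹ · X) i zero             ≈⟨ ·-identityˡ X i zero ⟩
    x i                         ∎
    where
    -- The vector as a one-column matrix, so that `·-assoc` applies.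
    X : Matrix n 1
    X p _ = x p

  -- Quadratic forms of a positive definite matrix and of its inverse.

  module _ {n} {A : Matrix n n} (A-pd : PositiveDefinite A) where

    open PositiveDefinite A-pd

    form-zero⇒zero : ∀ x → x ∙ (A ·ᵛ x) ≈ 0# → ∀ i → x i ≈ 0#
    form-zero⇒zero x xAx≈0 i = ¬#⇒≈ λ xᵢ#0 → <-irrefl (sym xAx≈0) (positive x (i , xᵢ#0))

    -- A negative value rules out `x i # 0#` for every `i`, since a nonzero vector has a positive
    -- value. By tightness `x` vanishes, and then so does the form.
    form-nonnegative : ∀ x → Nonnegative (x ∙ (A ·ᵛ x))
    form-nonnegative x xAx<0 = <-irrefl xAx≈0 xAx<0
      where
      x≈0 : ∀ i → x i ≈ 0#
      x≈0 i = ¬#⇒≈ λ xᵢ#0 → <-irrefl refl (<-trans xAx<0 (positive x (i , xᵢ#0)))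

      xAx≈0 : x ∙ (A ·ᵛ x) ≈ 0#
      xAx≈0 = sum-zero (λ i → trans (*-congʳ (x≈0 i)) (zeroˡ _))

    -- With z = A⁻¹x one has xᵀA⁻¹x = zᵀAz.
    inverseForm : ∀ x → x ∙ (A-pd ⁻¹ ·ᵛ x) ≈ (A-pd ⁻¹ ·ᵛ x) ∙ (A ·ᵛ (A-pd ⁻¹ ·ᵛ x))
    inverseForm x = sum-cong (λ i → trans (*-comm _ _) (*-congˡ (sym (·ᵛ-inverseʳ A-pd x i))))

    inverseForm-nonnegative : ∀ x → Nonnegative (x ∙ (A-pd ⁻¹ ·ᵛ x))
    inverseForm-nonnegative x = form-nonnegative (A-pd ⁻¹ ·ᵛ x) ∘ <-respˡ-≈ (inverseForm x)

    -- By `inverseForm`, z = A⁻¹x is a zero of the form of A, so z = 0 and x = Az = 0.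
    inverseForm-zero⇒zero : ∀ x → x ∙ (A-pd ⁻¹ ·ᵛ x) ≈ 0# → ∀ i → x i ≈ 0#
    inverseForm-zero⇒zero x eq i = begin
      x i                             ≈⟨ ·ᵛ-inverseʳ A-pd x i ⟨
      (A ·ᵛ (A-pd ⁻¹ ·ᵛ x)) i         ≈⟨ sum-zero (λ j → trans (*-congˡ (z≈0 j)) (zeroʳ _)) ⟩
      0#                              ∎
      where
      z≈0 : ∀ j → (A-pd ⁻¹ ·ᵛ x) j ≈ 0#
      z≈0 = form-zero⇒zero (A-pd ⁻¹ ·ᵛ x) (trans (sym (inverseForm x)) eq)


module LaplacianProperties {c ℓ₁ ℓ₂} (ℝ : RealNumbers c ℓ₁ ℓ₂) (n k : ℕ)
                           (G : MatrixWeighted.MatrixWeightedGraph ℝ n k) where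

  open RealNumbers ℝ
  open Matrices ℝ
  open MatrixWeighted ℝ n k
  open MatrixWeightedGraph G
  open MatrixProperties ℝ
  open IsStrictPartialOrder <-isStrictPartialOrder using () renaming (irrefl to <-irrefl)
  open SemiringSum semiring
  open CommutativeSemigroupProperties (CommutativeRing.*-commutativeSemigroup commutativeRing)
    using (xy∙z≈y∙xz)
  open AbelianGroupProperties +-abelianGroup
    using (⁻¹-anti-homo‿-; ⁻¹-∙-comm; x∙y⁻¹≈ε⇒x≈y; //-rightDividesˡ)
  open RingProperties ring using (-‿distribˡ-*; -‿distribʳ-*)
  open SetoidReasoning setoid

  -- Blocks of the Laplacian.

  L : BlockMatrix
  L = laplacian G

  Λ E : Fin n → Fin n → Matrix k k
  Λ = laplacianBlock G
  E = edgeInverse G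

  E-sym : ∀ i j → E i j ≈ᴹ E j i
  E-sym i j with i ∼? j | j ∼? i
  ... | yes i∼j | yes j∼i = ⁻¹-cong (W-posDef i∼j) (W-posDef j∼i) (W-sym i∼j)
  ... | yes i∼j | no  j≁i = contradiction (∼-sym i∼j) j≁i
  ... | no  i≁j | yes j∼i = contradiction (∼-sym j∼i) i≁j
  ... | no  _   | no  _   = λ _ _ → refl

  -- Degree matrix minus adjacency matrix, one formula for all cases of `laplacianBlock`. On the
  -- diagonal `E` vanishes because there are no loops.
  Λ-decomposition : ∀ i j a p → Λ i j a p ≈ 1ᴹ i j * sum (λ l → E i l a p) - E i j a p
  Λ-decomposition i j a p with i ≟ j | i ∼? j
  ... | yes ≡.refl | yes i∼i = contradiction i∼i loopless
  ... | yes ≡.refl | no  _   = sym (trans (x-0≈x _) (*-identityˡ _))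
  ... | no  _      | yes _   = sym (trans (+-congʳ (zeroˡ _)) (+-identityˡ _))
  ... | no  _      | no  _   = sym (trans (x-0≈x _) (zeroˡ _))

  -- The degree term lives on the diagonal, where exchanging the indices changes nothing; the other
  -- term is symmetric by `E-sym`.
  Λ-sym : ∀ i j → Λ i j ≈ᴹ Λ j i
  Λ-sym i j a p = begin
    Λ i j a p                 ≈⟨ Λ-decomposition i j a p ⟩
    1ᴹ i j * S i - E i j a p  ≈⟨ +-cong 1S≈1S (-‿cong (E-sym i j a p)) ⟩
    1ᴹ j i * S j - E j i a p  ≈⟨ Λ-decomposition j i a p ⟨
    Λ j i a p                 ∎
    where
    S : Fin n → Carrier
    S i = sum (λ l → E i l a p)

    1S≈1S : 1ᴹ i j * S i ≈ 1ᴹ j i * S j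
    1S≈1S = trans (1ᴹ-subst i j S) (*-congʳ (1ᴹ-sym i j))

  -- For fixed `a` and `p` the entries form a scalar weighted Laplacian, which acts through
  -- differences. Hence it kills constants and has zero row sums.
  Λ-action : ∀ i a p (f : Vector n) →
             sum (λ j → Λ i j a p * f j) ≈ sum (λ j → E i j a p * (f i - f j))
  Λ-action i a p f = begin
    sum (λ j → Λ i j a p * f j)
      ≈⟨ sum-cong (λ j → trans (*-congʳ (Λ-decomposition i j a p)) (*-distribʳ-- (f j) _ _)) ⟩
    sum (λ j → 1ᴹ i j * S * f j - E i j a p * f j)
      ≈⟨ sum-sub (λ j → 1ᴹ i j * S * f j) (λ j → E i j a p * f j) ⟩
    sum (λ j → 1ᴹ i j * S * f j) - sum (λ j → E i j a p * f j)
      ≈⟨ +-congʳ (trans (sum-cong (λ j → *-assoc (1ᴹ i j) S (f j))) (sum-1ᴹ i (λ j → S * f j))) ⟩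
    S * f i - sum (λ j → E i j a p * f j)
      ≈⟨ +-congʳ (*-distribʳ-sum (f i) (λ j → E i j a p)) ⟩
    sum (λ j → E i j a p * f i) - sum (λ j → E i j a p * f j)
      ≈⟨ sum-sub (λ j → E i j a p * f i) (λ j → E i j a p * f j) ⟨
    sum (λ j → E i j a p * f i - E i j a p * f j)
      ≈⟨ sum-cong (λ j → *-distribˡ-- (E i j a p) (f i) (f j)) ⟨
    sum (λ j → E i j a p * (f i - f j)) ∎
    where
    S : Carrier
    S = sum (λ l → E i l a p)

  Λ-rowSum : ∀ i a p x → sum (λ j → Λ i j a p * x) ≈ 0#
  Λ-rowSum i a p x =
    trans (Λ-action i a p (λ _ → x))
          (sum-zero (λ j → trans (*-congˡ (-‿inverseʳ x)) (zeroʳ (E i j a p))))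

  Λ-columnSum : ∀ j a p x → sum (λ i → Λ i j a p * x) ≈ 0#
  Λ-columnSum j a p x = trans (sum-cong (λ i → *-congʳ (Λ-sym i j a p))) (Λ-rowSum j a p x)

  -- Left null vectors of the Laplacian and their energy.

  module LeftNullVector (x : Fin n → Vector k)
    (null : ∀ j b → sum (λ i → sum (λ a → x i a * Λ i j a b)) ≈ 0#) where

    d : Fin n → Fin n → Vector k
    d i j a = x i a - x j a

    -- `Q i j` is the energy of a pair, zero for nonadjacent vertices. `F i j` is the share of it
    -- charged to the end `i`.
    F Q : Fin n → Fin n → Carrier
    F i j = d i j ∙ (E i j ·ᵛ x i)
    Q i j = d i j ∙ (E i j ·ᵛ d i j)

    -- Kirchhoff's law at vertex `i`: the equation `null i`, turned into differences by `Λ-sym` and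
    -- `Λ-action`.
    flow : ∀ i b → sum (λ a → sum (λ j → E i j a b * d i j a)) ≈ 0#
    flow i b = begin
      sum (λ a → sum (λ j → E i j a b * d i j a))
        ≈⟨ sum-cong (λ a → Λ-action i a b (λ j → x j a)) ⟨
      sum (λ a → sum (λ j → Λ i j a b * x j a))
        ≈⟨ sum-cong (λ a → sum-cong (λ j → trans (*-congʳ (Λ-sym i j a b)) (*-comm _ _))) ⟩
      sum (λ a → sum (λ j → x j a * Λ j i a b))
        ≈⟨ ∑-comm (λ a j → x j a * Λ j i a b) ⟩
      sum (λ j → sum (λ a → x j a * Λ j i a b))
        ≈⟨ null i b ⟩
      0# ∎

    -- The factor `x i b` does not depend on `j`, so after exchanging the sums it multiplies the
    -- flow at `i`, which is zero.
    F-rowSum : ∀ i → sum (F i) ≈ 0#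
    F-rowSum i = begin
      sum (λ j → sum (λ a → d i j a * sum (λ b → E i j a b * x i b)))
        ≈⟨ sum-cong (λ j → sum-cong (λ a → *-distribˡ-sum (d i j a) (λ b → E i j a b * x i b))) ⟩
      sum (λ j → sum (λ a → sum (λ b → d i j a * (E i j a b * x i b))))
        ≈⟨ sum-cong (λ j → ∑-comm (λ a b → d i j a * (E i j a b * x i b))) ⟩
      sum (λ j → sum (λ b → sum (λ a → d i j a * (E i j a b * x i b))))
        ≈⟨ ∑-comm (λ j b → sum (λ a → d i j a * (E i j a b * x i b))) ⟩
      sum (λ b → sum (λ j → sum (λ a → d i j a * (E i j a b * x i b))))
        ≈⟨ sum-cong (λ b → ∑-comm (λ j a → d i j a * (E i j a b * x i b))) ⟩
      sum (λ b → sum (λ a → sum (λ j → d i j a * (E i j a b * x i b))))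
        ≈⟨ sum-cong (λ b → sum-cong (λ a → sum-cong (λ j → xy∙z≈y∙xz (E i j a b) (d i j a) (x i b)))) ⟨
      sum (λ b → sum (λ a → sum (λ j → E i j a b * d i j a * x i b)))
        ≈⟨ sum-cong (λ b → sum-cong (λ a → *-distribʳ-sum (x i b) (λ j → E i j a b * d i j a))) ⟨
      sum (λ b → sum (λ a → sum (λ j → E i j a b * d i j a) * x i b))
        ≈⟨ sum-cong (λ b → *-distribʳ-sum (x i b) (λ a → sum (λ j → E i j a b * d i j a))) ⟨
      sum (λ b → sum (λ a → sum (λ j → E i j a b * d i j a)) * x i b)
        ≈⟨ sum-zero (λ b → trans (*-congʳ (flow i b)) (zeroˡ (x i b))) ⟩
      0# ∎

    -- Exchanging the ends negates `d` and preserves `E`, so the two shares combine to the form in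
    -- `x i - x j`.
    F+F≈Q : ∀ i j → F i j + F j i ≈ Q i j
    F+F≈Q i j = trans (sym (∑-distrib-+ (λ a → d i j a * (E i j ·ᵛ x i) a) (λ a → d j i a * (E j i ·ᵛ x j) a)))
                      (sum-cong term)
      where
      term : ∀ a → d i j a * (E i j ·ᵛ x i) a + d j i a * (E j i ·ᵛ x j) a ≈ d i j a * (E i j ·ᵛ d i j) a
      term a = begin
        d i j a * (E i j ·ᵛ x i) a + d j i a * (E j i ·ᵛ x j) a
          ≈⟨ +-congˡ (*-cong (sym (⁻¹-anti-homo‿- (x i a) (x j a))) (sum-cong (λ b → *-congʳ (E-sym j i a b)))) ⟩
        d i j a * (E i j ·ᵛ x i) a + - d i j a * (E i j ·ᵛ x j) a
          ≈⟨ +-congˡ (trans (sym (-‿distribˡ-* _ _)) (-‿distribʳ-* _ _)) ⟩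
        d i j a * (E i j ·ᵛ x i) a + d i j a * - (E i j ·ᵛ x j) a
          ≈⟨ distribˡ _ _ _ ⟨
        d i j a * ((E i j ·ᵛ x i) a - (E i j ·ᵛ x j) a)
          ≈⟨ *-congˡ (sum-sub (λ b → E i j a b * x i b) (λ b → E i j a b * x j b)) ⟨
        d i j a * sum (λ b → E i j a b * x i b - E i j a b * x j b)
          ≈⟨ *-congˡ (sum-cong (λ b → *-distribˡ-- (E i j a b) (x i b) (x j b))) ⟨
        d i j a * (E i j ·ᵛ d i j) a ∎

    Q-nonnegative : ∀ i j → Nonnegative (Q i j)
    Q-nonnegative i j with i ∼? j
    ... | yes i∼j = inverseForm-nonnegative (W-posDef i∼j) (d i j)
    ... | no  _   = <-irrefl (sum-zero (λ a → trans (*-congˡ (sum-zero (λ b → zeroˡ (d i j b)))) (zeroʳ (d i j a))))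

    -- Summed over ordered pairs, the two shares of `Q` have the same total, and each is a sum of
    -- vanishing row sums of `F`.
    totalEnergy : sum (λ i → sum (λ j → Q i j)) ≈ 0#
    totalEnergy = begin
      sum (λ i → sum (λ j → Q i j))
        ≈⟨ sum-cong (λ i → sum-cong (λ j → F+F≈Q i j)) ⟨
      sum (λ i → sum (λ j → F i j + F j i))
        ≈⟨ sum-cong (λ i → ∑-distrib-+ (F i) (λ j → F j i)) ⟩
      sum (λ i → sum (F i) + sum (λ j → F j i))
        ≈⟨ ∑-distrib-+ (λ i → sum (F i)) (λ i → sum (λ j → F j i)) ⟩
      sum (λ i → sum (F i)) + sum (λ i → sum (λ j → F j i))
        ≈⟨ +-congˡ (∑-comm (λ i j → F j i)) ⟩
      sum (λ i → sum (F i)) + sum (λ j → sum (F j))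
        ≈⟨ +-cong (sum-zero F-rowSum) (sum-zero F-rowSum) ⟩
      0# + 0#
        ≈⟨ +-identityˡ 0# ⟩
      0# ∎

    Q≈0 : ∀ i j → Q i j ≈ 0#
    Q≈0 i = nonnegative-sum-zero (Q-nonnegative i)
      (nonnegative-sum-zero (λ l → nonnegative-sum (Q-nonnegative l)) totalEnergy i)

    equalOnEdges : ∀ {i j} → i ∼ j → ∀ a → x i a ≈ x j a
    -- `Q≈0 i j` is abstracted together with the adjacency test, so that `E i j` in its type reduces
    -- to an inverse weight.
    equalOnEdges {i} {j} i∼j a with i ∼? j | Q≈0 i j
    ... | yes i∼j′ | Q≈0 = x∙y⁻¹≈ε⇒x≈y (x i a) (x j a) (inverseForm-zero⇒zero (W-posDef i∼j′) (d i j) Q≈0 a)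
    ... | no  i≁j  | _   = contradiction i∼j i≁j

    -- Equality across edges is propagated along a path from `i` to `j`.
    constant : ∀ i j a → x i a ≈ x j a
    constant i j = fold (λ i j → ∀ a → x i a ≈ x j a)
      (λ i∼l eq a → trans (equalOnEdges i∼l a) (eq a)) (λ _ → refl) (connected i j)

  -- Block entries of products with the Laplacian.

  block-fromBlocks : ∀ (B : Fin n → Fin n → Matrix k k) i j → block (fromBlocks B) i j ≈ᴹ B i j
  block-fromBlocks B i j a b = reflexive (≡.cong₂ (λ p q → B (proj₁ p) (proj₁ q) (proj₂ p) (proj₂ q))
    (remQuot-combine {n} {k} i a) (remQuot-combine {n} {k} j b))

  block-L· : ∀ (M : BlockMatrix) i j a b →
             block (L · M) i j a b ≈ sum (λ l → sum (λ p → Λ i l a p * block M l j p b))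
  block-L· M i j a b = trans (sum-combine n _)
    (sum-cong (λ l → sum-cong (λ p → *-congʳ (block-fromBlocks Λ i l a p))))

  block-·L : ∀ (M : BlockMatrix) P j b →
             (M · L) P (combine j b) ≈ sum (λ i → sum (λ a → M P (combine i a) * Λ i j a b))
  block-·L M P j b = trans (sum-combine n _)
    (sum-cong (λ i → sum-cong (λ a → *-congˡ (block-fromBlocks Λ i j a b))))

  -- The block trace of `L · C`.

  module OneInverse (C : BlockMatrix) (LCL≈L : IsOneInverse L C) where

    M : BlockMatrix
    M = L · C

    blockTrace : Matrix k k
    blockTrace a b = sum (λ i → block M i i a b)

    -- (LC - I)L = LCL - L, which is where the (1)-inverse property enters.
    M-1-null : (M -ᴹ 1ᴹ) · L ≈ᴹ 0ᴹ
    M-1-null p q = begin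
      ((M -ᴹ 1ᴹ) · L) p q          ≈⟨ ·-distribʳ-- M 1ᴹ L p q ⟩
      (M · L) p q - (1ᴹ · L) p q   ≈⟨ +-cong (LCL≈L p q) (-‿cong (·-identityˡ L p q)) ⟩
      L p q - L p q                ≈⟨ -‿inverseʳ (L p q) ⟩
      0#                           ∎

    M-1-constant : ∀ p i j b → (M -ᴹ 1ᴹ) p (combine i b) ≈ (M -ᴹ 1ᴹ) p (combine j b)
    M-1-constant p = LeftNullVector.constant (λ i a → (M -ᴹ 1ᴹ) p (combine i a))
      (λ j b → trans (sym (block-·L (M -ᴹ 1ᴹ) p j b)) (M-1-null p (combine j b)))

    -- Summing over `i` first meets only the block column sums of L, which are zero.
    M-columnSum : ∀ j a b → sum (λ i → block M i j a b) ≈ 0#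
    M-columnSum j a b = begin
      sum (λ i → block M i j a b)
        ≈⟨ sum-cong (λ i → block-L· C i j a b) ⟩
      sum (λ i → sum (λ l → sum (λ p → Λ i l a p * block C l j p b)))
        ≈⟨ ∑-comm (λ i l → sum (λ p → Λ i l a p * block C l j p b)) ⟩
      sum (λ l → sum (λ i → sum (λ p → Λ i l a p * block C l j p b)))
        ≈⟨ sum-cong (λ l → ∑-comm (λ i p → Λ i l a p * block C l j p b)) ⟩
      sum (λ l → sum (λ p → sum (λ i → Λ i l a p * block C l j p b)))
        ≈⟨ sum-zero (λ l → sum-zero (λ p → Λ-columnSum l a p (block C l j p b))) ⟩
      0# ∎

    -- With `o` a fixed vertex, constancy along rows replaces the diagonal block of M - I by the one
    -- in block column `o`. In the sum that block column of M contributes zero, the correction at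
    -- `i = o` gives -I, and the restored identities give nI.
    blockTrace≈ : Fin n → ∀ a b → blockTrace a b ≈ (fromℕ n - 1#) * 1ᴹ a b
    blockTrace≈ o a b = begin
      sum (λ i → block M i i a b)
        ≈⟨ sum-cong diagonal ⟩
      sum (λ i → block M i o a b - 1ᴹ i o * 1ᴹ a b + 1# * 1ᴹ a b)
        ≈⟨ ∑-distrib-+ (λ i → block M i o a b - 1ᴹ i o * 1ᴹ a b) (λ _ → 1# * 1ᴹ a b) ⟩
      sum (λ i → block M i o a b - 1ᴹ i o * 1ᴹ a b) + sum {n} (λ _ → 1# * 1ᴹ a b)
        ≈⟨ +-cong (sum-sub (λ i → block M i o a b) (λ i → 1ᴹ i o * 1ᴹ a b)) (sym (*-distribʳ-sum {n} (1ᴹ a b) (λ _ → 1#))) ⟩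
      sum (λ i → block M i o a b) - sum (λ i → 1ᴹ i o * 1ᴹ a b) + sum {n} (λ _ → 1#) * 1ᴹ a b
        ≈⟨ +-cong (+-cong (M-columnSum o a b)
             (-‿cong (trans (sum-cong (λ i → *-congʳ (1ᴹ-sym i o))) (sum-1ᴹ o (λ _ → 1ᴹ a b)))))
             (*-congʳ (sum-replicate n)) ⟩
      0# - 1ᴹ a b + fromℕ n * 1ᴹ a b
        ≈⟨ trans (+-congʳ (+-identityˡ _)) (+-comm _ _) ⟩
      fromℕ n * 1ᴹ a b - 1ᴹ a b
        ≈⟨ +-congˡ (-‿cong (*-identityˡ (1ᴹ a b))) ⟨
      fromℕ n * 1ᴹ a b - 1# * 1ᴹ a b
        ≈⟨ *-distribʳ-- (1ᴹ a b) (fromℕ n) 1# ⟨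
      (fromℕ n - 1#) * 1ᴹ a b ∎
      where
      diagonal : ∀ i → block M i i a b ≈ block M i o a b - 1ᴹ i o * 1ᴹ a b + 1# * 1ᴹ a b
      diagonal i = begin
        block M i i a b
          ≈⟨ //-rightDividesˡ (1ᴹ (combine i a) (combine i b)) (block M i i a b) ⟨
        block (M -ᴹ 1ᴹ) i i a b + 1ᴹ (combine i a) (combine i b)
          ≈⟨ +-cong (M-1-constant (combine i a) i o b)
                    (trans (1ᴹ-combine i i a b) (*-congʳ (1ᴹ-diagonal i))) ⟩
        block (M -ᴹ 1ᴹ) i o a b + 1# * 1ᴹ a b
          ≈⟨ +-congʳ (+-congˡ (-‿cong (1ᴹ-combine i o a b))) ⟩
        block M i o a b - 1ᴹ i o * 1ᴹ a b + 1# * 1ᴹ a b ∎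

    -- Contraction of block families against the Laplacian.

    -- If `g i j` is column b of a block X_ij, this is the (a, b) entry of the sum of all Λ_ij X_ij.
    -- Fixing the column makes it a scalar linear functional.
    contract : Fin k → (Fin n → Fin n → Vector k) → Carrier
    contract a g = sum (λ i → sum (λ j → sum (λ p → Λ i j a p * g i j p)))

    contract-+ : ∀ a g h → contract a (λ i j p → g i j p + h i j p) ≈ contract a g + contract a h
    contract-+ a g h = begin
      sum (λ i → sum (λ j → sum (λ p → Λ i j a p * (g i j p + h i j p))))
        ≈⟨ sum-cong (λ i → sum-cong (λ j → trans
             (sum-cong (λ p → distribˡ (Λ i j a p) (g i j p) (h i j p)))
             (∑-distrib-+ (λ p → Λ i j a p * g i j p) (λ p → Λ i j a p * h i j p)))) ⟩
      sum (λ i → sum (λ j → G′ i j + H i j))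
        ≈⟨ sum-cong (λ i → ∑-distrib-+ (G′ i) (H i)) ⟩
      sum (λ i → sum (G′ i) + sum (H i))
        ≈⟨ ∑-distrib-+ (λ i → sum (G′ i)) (λ i → sum (H i)) ⟩
      contract a g + contract a h ∎
      where
      G′ H : Fin n → Fin n → Carrier
      G′ i j = sum (λ p → Λ i j a p * g i j p)
      H i j = sum (λ p → Λ i j a p * h i j p)

    contract-neg : ∀ a g → contract a (λ i j p → - g i j p) ≈ - contract a g
    contract-neg a g = begin
      sum (λ i → sum (λ j → sum (λ p → Λ i j a p * - g i j p)))
        ≈⟨ sum-cong (λ i → sum-cong (λ j → trans
             (sum-cong (λ p → sym (-‿distribʳ-* (Λ i j a p) (g i j p))))
             (sum-neg (λ p → Λ i j a p * g i j p)))) ⟩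
      sum (λ i → sum (λ j → - sum (λ p → Λ i j a p * g i j p)))
        ≈⟨ sum-cong (λ i → sum-neg (λ j → sum (λ p → Λ i j a p * g i j p))) ⟩
      sum (λ i → - sum (λ j → sum (λ p → Λ i j a p * g i j p)))
        ≈⟨ sum-neg (λ i → sum (λ j → sum (λ p → Λ i j a p * g i j p))) ⟩
      - contract a g ∎

    contract-sub : ∀ a g h → contract a (λ i j p → g i j p - h i j p) ≈ contract a g - contract a h
    contract-sub a g h = trans (contract-+ a g (λ i j p → - h i j p)) (+-congˡ (contract-neg a h))

    contract-row : ∀ a (g : Fin n → Vector k) → contract a (λ i _ → g i) ≈ 0#
    contract-row a g = sum-zero (λ i → trans (∑-comm (λ j p → Λ i j a p * g i p))
                                             (sum-zero (λ p → Λ-rowSum i a p (g i p))))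

    -- Renaming the summation indices moves the transposition onto `Λ`, where `Λ-sym` absorbs it.
    contract-transpose : ∀ a g → contract a (λ i j → g j i) ≈ contract a g
    contract-transpose a g =
      trans (∑-comm (λ i j → sum (λ p → Λ i j a p * g j i p)))
            (sum-cong (λ j → sum-cong (λ i → sum-cong (λ p → *-congʳ (Λ-sym i j a p)))))

    contract-column : ∀ a (g : Fin n → Vector k) → contract a (λ _ j → g j) ≈ 0#
    contract-column a g = trans (contract-transpose a (λ i _ → g i)) (contract-row a g)

    contract-C : ∀ a b → contract a (λ i j p → block C j i p b) ≈ blockTrace a b
    contract-C a b = sum-cong (λ i → sym (block-L· C i i a b))

    -- The terms C_ii and C_jj of R_ij are constant along a block row or block column of L and
    -- contract to zero. The terms C_ij and C_ji each contract to the block trace, the former after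
    -- transposition.
    ‖L⊠R‖ : ∀ a b → ‖ L ⊠ resistance C ‖ a b ≈ - (blockTrace a b + blockTrace a b)
    ‖L⊠R‖ a b = begin
      ‖ L ⊠ resistance C ‖ a b
        ≈⟨ sum-cong (λ i → sum-cong (λ j → trans (block-fromBlocks LRᵇ i j a b)
             (sum-cong (λ p → *-cong (block-fromBlocks Λ i j a p) (block-fromBlocks Rᵇ i j p b))))) ⟩
      contract a (λ i j p → Cᵢᵢ i j p + Cⱼⱼ i j p - Cᵢⱼ i j p - Cⱼᵢ i j p)
        ≈⟨ contract-sub a (λ i j p → Cᵢᵢ i j p + Cⱼⱼ i j p - Cᵢⱼ i j p) Cⱼᵢ ⟩
      contract a (λ i j p → Cᵢᵢ i j p + Cⱼⱼ i j p - Cᵢⱼ i j p) - contract a Cⱼᵢ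
        ≈⟨ +-congʳ (contract-sub a (λ i j p → Cᵢᵢ i j p + Cⱼⱼ i j p) Cᵢⱼ) ⟩
      contract a (λ i j p → Cᵢᵢ i j p + Cⱼⱼ i j p) - contract a Cᵢⱼ - contract a Cⱼᵢ
        ≈⟨ +-cong (+-cong
             (trans (contract-+ a Cᵢᵢ Cⱼⱼ)
                    (+-cong (contract-row a (λ i p → block C i i p b)) (contract-column a (λ j p → block C j j p b))))
             (-‿cong (trans (contract-transpose a Cⱼᵢ) (contract-C a b))))
             (-‿cong (contract-C a b)) ⟩
      0# + 0# - blockTrace a b - blockTrace a b
        ≈⟨ +-congʳ (trans (+-congʳ (+-identityˡ 0#)) (+-identityˡ _)) ⟩
      - blockTrace a b - blockTrace a b
        ≈⟨ ⁻¹-∙-comm _ _ ⟩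
      - (blockTrace a b + blockTrace a b) ∎
      where
      Rᵇ LRᵇ : Fin n → Fin n → Matrix k k
      Rᵇ i j = block C i i +ᴹ block C j j -ᴹ block C i j -ᴹ block C j i
      LRᵇ i j = block L i j · block (resistance C) i j

      Cᵢᵢ Cⱼⱼ Cᵢⱼ Cⱼᵢ : Fin n → Fin n → Vector k
      Cᵢᵢ i j p = block C i i p b
      Cⱼⱼ i j p = block C j j p b
      Cᵢⱼ i j p = block C i j p b
      Cⱼᵢ i j p = block C j i p b

-- `NonZero n` says that there is at least one vertex. With none, the left side would be zero and
-- the right side twice the identity.
theorem3p5 : ∀ {c ℓ₁ ℓ₂} (ℝ : RealNumbers c ℓ₁ ℓ₂) (n k : ℕ) .{{_ : NonZero n}} →
  let open RealNumbers ℝ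
      open Matrices ℝ
      open MatrixWeighted ℝ n k
  in (G : MatrixWeightedGraph) (L⁽¹⁾ : BlockMatrix) → IsOneInverse (laplacian G) L⁽¹⁾ →
     ‖ laplacian G ⊠ resistance L⁽¹⁾ ‖ ≈ᴹ (- (fromℕ 2 * (fromℕ n - 1#))) • 1ᴹ
theorem3p5 ℝ n@(ℕ.suc _) k G C LCL≈L a b = begin
  ‖ L ⊠ resistance C ‖ a b              ≈⟨ ‖L⊠R‖ a b ⟩
  -- The vertex `zero` serves as the reference vertex; it exists because `n` is a successor.
  - (blockTrace a b + blockTrace a b)   ≈⟨ -‿cong (+-cong (blockTrace≈ zero a b) (blockTrace≈ zero a b)) ⟩
  - (t * 1ᴹ a b + t * 1ᴹ a b)           ≈⟨ -‿cong (distribʳ (1ᴹ a b) t t) ⟨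
  - ((t + t) * 1ᴹ a b)                  ≈⟨ -‿distribˡ-* (t + t) (1ᴹ a b) ⟩
  - (t + t) * 1ᴹ a b                    ≈⟨ *-congʳ (-‿cong 2t≈t+t) ⟨
  - (fromℕ 2 * t) * 1ᴹ a b              ∎
  where
  open RealNumbers ℝ
  open Matrices ℝ
  open MatrixWeighted ℝ n k
  open LaplacianProperties ℝ n k G
  open OneInverse C LCL≈L
  open RingProperties ring using (-‿distribˡ-*)
  open SetoidReasoning setoid

  t : Carrier
  t = fromℕ n - 1#

  2t≈t+t : fromℕ 2 * t ≈ t + t
  -- `fromℕ 2` unfolds to `1# + (1# + 0#)`.
  2t≈t+t = trans (distribʳ t 1# (1# + 0#))
    (+-cong (*-identityˡ t) (trans (*-congʳ (+-identityʳ 1#)) (*-identityˡ t)))
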